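{- Let $n, m, k, s$ be positive integers such that $1 \leq s \leq n-1$ and $1 < k < (m-1)n - 1$. Then there is an $s$-ocycle for $\mathcal{B}_k(m,n)$ if and only if $n - s > \gcd(n,s)$.
   Context: An $m$-ary word (string) of length $n$ is a sequence $x = x_1x_2\ldots x_n$ with each $x_i \in \{0,1,\ldots,m-1\}$. Its weight is $wt(x) = \sum_{i=1}^n x_i$ (sum of integers). $\mathcal{B}_k(m,n)$ denotes the set of all $m$-ary words of length $n$ and weight $k$. For a set $S$ of strings of length $n$ and an integer $s$ with $1 \le s \le n-1$, an $s$-overlap cycle ($s$-ocycle) for $S$ is a cyclic ordering of $S$, in which each element of $S$ appears exactly once, such that whenever $x = x_1\ldots x_n$ is followed by $y = y_1 \ldots y_n$ one has $x_{n-s+i} = y_i$ for all $i \in \{1,\ldots,s\}$ (the last $s$ letters of $x$ equal the first $s$ letters of $y$). The ordering being cyclic means that the last element of the ordering is followed by the first, and the overlap condition is also required there. -}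

module Defs where

open import Data.Fin using (Fin; toℕ)
open import Data.List using (List; _++_; take; drop)
open import Data.List.Membership.Propositional using (_∈_)
open import Data.List.Relation.Unary.Linked using (Linked)
open import Data.List.Relation.Unary.Unique.Propositional using (Unique)
open import Data.Nat using (ℕ; _∸_)
open import Data.Product using (Σ-syntax)
open import Data.Vec using (Vec; map; sum; toList)
open import Function.Bundles using (_⇔_)
open import Level using (0ℓ)
open import Relation.Binary.PropositionalEquality using (_≡_)
open import Relation.Unary using (Pred)

Word : ℕ → ℕ → Set
Word m n = Vec (Fin m) n

wt : ∀ {m n} → Word m n → ℕ
wt x = sum (map toℕ x)

𝓑 : (k m n : ℕ) → Pred (Word m n) 0ℓ
𝓑 k m n x = wt x ≡ k

-- Only meaningful for s ≤ n: then both sides are lists of exactly s letters.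
Overlap : ∀ {m n} → ℕ → Word m n → Word m n → Set
Overlap {n = n} s x y = drop (n ∸ s) (toList x) ≡ take s (toList y)

-- A cyclic ordering is represented by the list obtained by cutting it open at
-- any point.  Appending the first word again makes Linked also compare the last
-- word with the first; in particular a one-word cycle must overlap itself.
record IsOcycle {m n : ℕ} (s : ℕ) (S : Pred (Word m n) 0ℓ)
                (ws : List (Word m n)) : Set where
  field
    unique     : Unique ws
    enumerates : ∀ x → x ∈ ws ⇔ S x
    overlaps   : Linked (Overlap s) (ws ++ take 1 ws)

HasOcycle : {m n : ℕ} → ℕ → Pred (Word m n) 0ℓ → Set
HasOcycle {m} {n} s S = Σ[ ws ∈ List (Word m n) ] IsOcycle s S ws

{-# OPTIONS --safe #-}

-- Write d = n ∸ s.  The condition n ∸ s > gcd n s says that d does not divide n.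
--
-- If d divides n, passing to the next word of an s-ocycle rotates the cyclic
-- sequence of the weights of the n / d consecutive blocks of length d, so every
-- rotation-invariant function of that sequence is constant on 𝓑 k m n.  Two
-- words of weight k contradict this: the sum of the squared block weights
-- separates them, or, when the block weights are 0 and 1, the sum of products
-- of cyclically adjacent ones.
--
-- If d does not divide n, let π be rotation by d letters; x may always be
-- followed by π x.  A cyclic list closed under π is a union of π-orbits, and a
-- further π-orbit can be spliced in before x whenever it contains a word with
-- the same s-letter prefix as x.  It remains to connect any two words of weight
-- k by rotations π and changes that keep the s-letter prefix.  Together these
-- permit any weight-preserving change inside a cyclic window of length d that
-- starts at a multiple of d modulo n.  Since d ∤ n, every pair of adjacent
-- positions lies in such a window, and transfers of weight between adjacent
-- letters connect all words of equal weight.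
module Submission where

open import Defs
open import Data.Fin using (Fin; toℕ; fromℕ<; zero; suc)
import Data.Fin.Properties as Fin
open import Data.Fin.Properties using (toℕ<n; toℕ-fromℕ<; toℕ-injective; toℕ≤pred[n])
open import Data.List
  using (List; []; _∷_; _++_; [_]; take; drop; length; applyUpTo; allFin; cartesianProductWith; filter)
import Data.List as List
import Data.List.Membership.DecPropositional as DecMembership
open import Data.List.Membership.Propositional using (_∈_)
open import Data.List.Membership.Propositional.Properties
  using (∈-∃++; ∈-++⁺ˡ; ∈-++⁺ʳ; ∈-++⁻; ∈-applyUpTo⁺; ∈-applyUpTo⁻; ∈-allFin;
         ∈-cartesianProductWith⁺; ∈-filter⁺; ∈-filter⁻)
import Data.List.Properties as List
open import Data.List.Properties
  using (++-assoc; ++-identityʳ; applyUpTo-∷ʳ; length-take; length-drop; take++drop≡id; drop-drop; map-++)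
open import Data.List.Relation.Binary.Permutation.Propositional using (_↭_; ↭-sym; ↭⇒↭ₛ)
open import Data.List.Relation.Binary.Permutation.Propositional.Properties using (∈-resp-↭; ++-comm)
import Data.List.Relation.Binary.Permutation.Setoid.Properties as PermutationSetoid
open import Data.List.Relation.Binary.Subset.Propositional using (_⊆_)
open import Data.List.Relation.Unary.AllPairs using ([])
open import Data.List.Relation.Unary.Any using (here; there)
open import Data.List.Relation.Unary.Linked using (Linked; []; [-]; _∷_)
import Data.List.Relation.Unary.Linked.Properties as Linked
open import Data.List.Relation.Unary.Unique.Propositional using (Unique)
import Data.List.Relation.Unary.Unique.Propositional.Properties as Unique
open import Data.Nat
open import Data.Nat.Divisibility
open import Data.Nat.DivMod
open import Data.Nat.GCD using (gcd; gcd-greatest; gcd[m,n]∣m; gcd[m,n]∣n; gcd[m,n]≢0)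
open import Data.Nat.GeneralisedArithmetic using (fold; fold-+)
open import Data.Nat.ListAction using (sum)
open import Data.Nat.ListAction.Properties using (sum-++)
open import Data.Nat.Properties
open import Data.Nat.Solver using (module +-*-Solver)
open import Data.Product using (∃; ∃₂; _×_; _,_; proj₁; proj₂)
open import Data.Sum using (inj₁; inj₂; [_,_]′)
open import Data.Vec using (Vec; []; _∷_; toList; _∷ʳ_)
import Data.Vec as Vec
open import Data.Vec.Properties
  using (length-toList; toList-∷ʳ; toList-++; toList-injective; cast-is-id; ≡-dec)
open import Function using (_∘_; id)
open import Function.Bundles using (_⇔_; Equivalence; mk⇔)
open import Level using (0ℓ)
open import Relation.Binary using (Rel; DecidableEquality)
open import Relation.Binary.Construct.Closure.Equivalence using (EqClosure)
import Relation.Binary.Construct.Closure.Equivalence as Eq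
open import Relation.Binary.Construct.Closure.ReflexiveTransitive using (Star; ε; _◅_; _◅◅_)
import Relation.Binary.Construct.Closure.ReflexiveTransitive as Star
open import Relation.Binary.Construct.Closure.Symmetric using (SymClosure; fwd; bwd)
open import Relation.Binary.PropositionalEquality
  using (_≡_; _≢_; refl; sym; trans; cong; cong₂; subst; setoid; module ≡-Reasoning)
open import Relation.Nullary using (¬_; yes; no; contradiction)
open import Relation.Unary using (Pred; Decidable)

-- Cyclic lists: cutting open, rotating, joining.

Cyclic : {A : Set} → Rel A 0ℓ → List A → Set
Cyclic R ws = Linked R (ws ++ take 1 ws)

module _ {A : Set} {R : Rel A 0ℓ} where

  Linked-++⁻ˡ : ∀ xs {z ys} → Linked R (xs ++ z ∷ ys) → Linked R (xs ++ [ z ])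
  Linked-++⁻ˡ []           _       = [-]
  Linked-++⁻ˡ (x ∷ [])     (r ∷ l) = r ∷ [-]
  Linked-++⁻ˡ (x ∷ y ∷ xs) (r ∷ l) = r ∷ Linked-++⁻ˡ (y ∷ xs) l

  Linked-++⁻ʳ : ∀ xs {z ys} → Linked R (xs ++ z ∷ ys) → Linked R (z ∷ ys)
  Linked-++⁻ʳ []           l       = l
  Linked-++⁻ʳ (x ∷ [])     (r ∷ l) = l
  Linked-++⁻ʳ (x ∷ y ∷ xs) (r ∷ l) = Linked-++⁻ʳ (y ∷ xs) l

  Linked-join : ∀ xs {z ys} → Linked R (xs ++ [ z ]) → Linked R (z ∷ ys) →
                Linked R (xs ++ z ∷ ys)
  Linked-join []           _       l′ = l′
  Linked-join (x ∷ [])     (r ∷ _) l′ = r ∷ l′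
  Linked-join (x ∷ y ∷ xs) (r ∷ l) l′ = r ∷ Linked-join (y ∷ xs) l l′

  Linked-replaceLast : ∀ xs {y z} → (∀ {p} → R p y → R p z) →
                       Linked R (xs ++ [ y ]) → Linked R (xs ++ [ z ])
  Linked-replaceLast []           f _       = [-]
  Linked-replaceLast (x ∷ [])     f (r ∷ _) = f r ∷ [-]
  Linked-replaceLast (x ∷ w ∷ xs) f (r ∷ l) = r ∷ Linked-replaceLast (w ∷ xs) f l

  Cyclic-rotate : ∀ xs {z ys} → Cyclic R (xs ++ z ∷ ys) → Cyclic R (z ∷ ys ++ xs)
  Cyclic-rotate [] {z} {ys} l = subst (λ vs → Linked R (z ∷ vs ++ [ z ])) (sym (++-identityʳ ys)) l
  Cyclic-rotate (x ∷ xs) {z} {ys} l =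
    subst (Linked R) (sym (++-assoc (z ∷ ys) (x ∷ xs) [ z ]))
      (Linked-join (z ∷ ys) (Linked-++⁻ʳ (x ∷ xs) l′) (Linked-++⁻ˡ (x ∷ xs) l′))
    where
    l′ : Linked R (x ∷ xs ++ z ∷ ys ++ [ x ])
    l′ = subst (Linked R) (++-assoc (x ∷ xs) (z ∷ ys) [ x ]) l

  -- Since `y` and `z` have the same predecessors, the two cycles may trade closing links: the last
  -- element of each now leads into the head of the other.
  Cyclic-join : ∀ {y ys z zs} → (∀ {p} → R p y ⇔ R p z) →
                Cyclic R (y ∷ ys) → Cyclic R (z ∷ zs) → Cyclic R ((y ∷ ys) ++ z ∷ zs)
  Cyclic-join {y} {ys} {z} {zs} y⇔z l l′ =
    subst (Linked R) (sym (++-assoc (y ∷ ys) (z ∷ zs) [ y ]))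
      (Linked-join (y ∷ ys)
        (Linked-replaceLast (y ∷ ys) (Equivalence.to y⇔z) l)
        (Linked-replaceLast (z ∷ zs) (Equivalence.from y⇔z) l′))

-- Growing a cycle by orbits of a periodic map.

least : {P : Pred ℕ 0ℓ} → Decidable P → ∀ n → P n →
        ∃ λ p → P p × (∀ {i} → i < p → ¬ P i)
least P? n Pn with P? 0
least P? n       Pn | yes P0 = 0 , P0 , λ ()
least P? zero    Pn | no ¬P0 = contradiction Pn ¬P0
least P? (suc n) Pn | no ¬P0 with p , Pp , minimal ← least (P? ∘ suc) n Pn =
  suc p , Pp , λ { {zero} _ → ¬P0 ; {suc i} (s≤s i<p) → minimal i<p }

fold-suc : {A : Set} (f : A → A) (x : A) → ∀ n → fold x f (suc n) ≡ fold (f x) f n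
fold-suc f x zero    = refl
fold-suc f x (suc n) = cong f (fold-suc f x n)

module CycleJoining
  {A : Set} (_≟_ : DecidableEquality A) (R : Rel A 0ℓ) (S : Pred A 0ℓ)
  (π : A → A) (N : ℕ) (π-periodic : ∀ x → fold x π (suc N) ≡ x)
  (π-linked : ∀ x → R x (π x)) (π-preserves : ∀ {x} → S x → S (π x))
  where

  open DecMembership _≟_ using (_∈?_)

  -- Asking for `S x ⇔ S y` rather than for both memberships lets membership in `S` travel along a
  -- step in either direction.
  data Step (x y : A) : Set where
    rotated     : π x ≡ y → Step x y
    exchangeable : S x ⇔ S y → (∀ {p} → R p x ⇔ R p y) → Step x y

  -- The field `closed` makes the list a union of `π`-orbits, so an orbit that starts outside it
  -- avoids it altogether.
  record ClosedCycle (ws : List A) : Set where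
    field
      unique : Unique ws
      sound  : ∀ {x} → x ∈ ws → S x
      cyclic : Cyclic R ws
      closed : ∀ {x} → x ∈ ws → π x ∈ ws

  open ClosedCycle

  fold-closed : ∀ {ws} → ClosedCycle ws → ∀ {x} n → x ∈ ws → fold x π n ∈ ws
  fold-closed C zero    x∈ws = x∈ws
  fold-closed C (suc n) x∈ws = closed C (fold-closed C n x∈ws)

  -- From `π x`, another `N` applications of `π` complete the period and return to `x`.
  π-reflects-∈ : ∀ {ws} → ClosedCycle ws → ∀ {x} → π x ∈ ws → x ∈ ws
  π-reflects-∈ {ws} C {x} πx∈ws =
    subst (_∈ ws) (trans (sym (fold-suc π x N)) (π-periodic x)) (fold-closed C N πx∈ws)

  fold-reflects-∈ : ∀ {ws} → ClosedCycle ws → ∀ {x} n → fold x π n ∈ ws → x ∈ ws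
  fold-reflects-∈ C zero    x∈ws = x∈ws
  fold-reflects-∈ C (suc n) p    = fold-reflects-∈ C n (π-reflects-∈ C p)

  π-injective : ∀ {x y} → π x ≡ π y → x ≡ y
  π-injective {x} {y} eq = begin
    x                ≡⟨ π-periodic x ⟨
    fold x π (suc N) ≡⟨ fold-suc π x N ⟩
    fold (π x) π N   ≡⟨ cong (λ v → fold v π N) eq ⟩
    fold (π y) π N   ≡⟨ fold-suc π y N ⟨
    fold y π (suc N) ≡⟨ π-periodic y ⟩
    y                ∎
    where open ≡-Reasoning

  fold-injective : ∀ n {x y} → fold x π n ≡ fold y π n → x ≡ y
  fold-injective zero    eq = eq
  fold-injective (suc n) eq = fold-injective n (π-injective eq)

  module Orbit (y : A) (Sy : S y) where

    private
      -- Here `p` is one less than the minimal period of `y`.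
      minimalPeriod = least (λ i → fold y π (suc i) ≟ y) N (π-periodic y)
      p       = proj₁ minimalPeriod
      period  = proj₁ (proj₂ minimalPeriod)
      minimal = proj₂ (proj₂ minimalPeriod)

      f : ℕ → A
      f = fold y π

    tail : List A
    tail = applyUpTo (f ∘ suc) p

    orbit-unique : Unique (y ∷ tail)
    orbit-unique = Unique.applyUpTo⁺₁ f (suc p) distinct
      where
      distinct : ∀ {i j} → i < j → j < suc p → f i ≢ f j
      distinct {i} {j} i<j j<1+p fi≡fj with k , refl ← m≤n⇒∃[o]m+o≡n i<j =
        -- With `j = suc i + k`, cancelling `i` applications of `π` leaves the period `suc k`, and
        -- `k < p` contradicts minimality.
        minimal (≤-trans (s≤s (m≤n+m k i)) (s≤s⁻¹ j<1+p)) (fold-injective i (begin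
          fold (fold y π (suc k)) π i ≡⟨ fold-+ y π i ⟨
          f (i + suc k)               ≡⟨ cong f (+-suc i k) ⟩
          f (suc i + k)               ≡⟨ fi≡fj ⟨
          f i                         ∎))
        where open ≡-Reasoning

    f-sound : ∀ i → S (f i)
    f-sound zero    = Sy
    f-sound (suc i) = π-preserves (f-sound i)

    orbit-closed : ∀ {x} → x ∈ y ∷ tail → π x ∈ y ∷ tail
    orbit-closed x∈ with i , i<1+p , refl ← ∈-applyUpTo⁻ f x∈ with suc i <? suc p
    ... | yes 1+i<1+p = ∈-applyUpTo⁺ f 1+i<1+p
    ... | no  1+i≮1+p = here (trans (cong (f ∘ suc) (≤-antisym (s≤s⁻¹ i<1+p) (s≤s⁻¹ (≮⇒≥ 1+i≮1+p)))) period)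

    orbit-cycle : ClosedCycle (y ∷ tail)
    orbit-cycle = record
      { unique = orbit-unique
      ; sound  = λ x∈ → let i , _ , x≡ = ∈-applyUpTo⁻ f x∈ in subst S (sym x≡) (f-sound i)
      -- As `f (suc p)` is `y`, the orbit listed with one extra term is the orbit followed by its
      -- own first element.
      ; cyclic = subst (Linked R)
                   (trans (sym (applyUpTo-∷ʳ f (suc p))) (cong (λ v → (y ∷ tail) ++ [ v ]) period))
                   (Linked.applyUpTo⁺₂ f (suc (suc p)) (λ i → π-linked (f i)))
      ; closed = orbit-closed
      }

    orbit-disjoint : ∀ {ws} → ClosedCycle ws → ¬ y ∈ ws → ∀ {x} → ¬ (x ∈ y ∷ tail × x ∈ ws)
    orbit-disjoint C y∉ws (x∈ , x∈ws) with i , _ , refl ← ∈-applyUpTo⁻ f x∈ =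
      y∉ws (fold-reflects-∈ C i x∈ws)

  Extension : List A → A → Set
  Extension ws y = ∃ λ ws′ → ClosedCycle ws′ × ws ⊆ ws′ × y ∈ ws′

  rotate-cycle : ∀ xs {z ys} → ClosedCycle (xs ++ z ∷ ys) → ClosedCycle (z ∷ ys ++ xs)
  rotate-cycle xs {z} {ys} C = record
    { unique = PermutationSetoid.Unique-resp-↭ (setoid A) (↭⇒↭ₛ perm) (unique C)
    ; sound  = sound C ∘ ∈-resp-↭ (↭-sym perm)
    ; cyclic = Cyclic-rotate xs (cyclic C)
    ; closed = ∈-resp-↭ perm ∘ closed C ∘ ∈-resp-↭ (↭-sym perm)
    }
    where
    perm : xs ++ z ∷ ys ↭ z ∷ ys ++ xs
    perm = ++-comm xs (z ∷ ys)

  join-cycles : ∀ {y ys z zs} → (∀ {p} → R p y ⇔ R p z) → (∀ {x} → ¬ (x ∈ y ∷ ys × x ∈ z ∷ zs)) →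
         ClosedCycle (y ∷ ys) → ClosedCycle (z ∷ zs) → ClosedCycle ((y ∷ ys) ++ z ∷ zs)
  join-cycles {y} {ys} y⇔z disjoint C D = record
    { unique = Unique.++⁺ (unique C) (unique D) disjoint
    ; sound  = λ x∈ → [ sound C , sound D ]′ (∈-++⁻ (y ∷ ys) x∈)
    ; cyclic = Cyclic-join y⇔z (cyclic C) (cyclic D)
    ; closed = λ x∈ → [ ∈-++⁺ˡ ∘ closed C , ∈-++⁺ʳ (y ∷ ys) ∘ closed D ]′ (∈-++⁻ (y ∷ ys) x∈)
    }

  -- If `y` is not yet on the cycle, the cycle is cut open at `z` and the whole orbit of `y` is put
  -- in front. `Cyclic-join` applies because `y` and `z` share their predecessors, and no element
  -- repeats because the cycle is closed under `π`.
  extend-exchangeable : ∀ {ws z y} → ClosedCycle ws → z ∈ ws → S y →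
                       (∀ {p} → R p y ⇔ R p z) → Extension ws y
  extend-exchangeable {ws} {z} {y} C z∈ws Sy y⇔z with y ∈? ws
  ... | yes y∈ws = ws , C , id , y∈ws
  ... | no  y∉ws with xs , ys , refl ← ∈-∃++ z∈ws =
    (y ∷ tail) ++ z ∷ ys ++ xs
    , join-cycles y⇔z (orbit-disjoint C′ (y∉ws ∘ ∈-resp-↭ (++-comm (z ∷ ys) xs))) orbit-cycle C′
    , ∈-++⁺ʳ (y ∷ tail) ∘ ∈-resp-↭ (++-comm xs (z ∷ ys))
    , here refl
    where
    open Orbit y Sy
    C′ = rotate-cycle xs C

  extend-step : ∀ {ws z y} → ClosedCycle ws → z ∈ ws → SymClosure Step z y → Extension ws y
  extend-step C z∈ws (fwd (rotated refl))         = _ , C , id , closed C z∈ws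
  extend-step C z∈ws (bwd (rotated refl))         = _ , C , id , π-reflects-∈ C z∈ws
  extend-step C z∈ws (fwd (exchangeable Sz⇔Sy z⇔y)) =
    extend-exchangeable C z∈ws (Equivalence.to Sz⇔Sy (sound C z∈ws))
      (mk⇔ (Equivalence.from z⇔y) (Equivalence.to z⇔y))
  extend-step C z∈ws (bwd (exchangeable Sy⇔Sz y⇔z)) =
    extend-exchangeable C z∈ws (Equivalence.from Sy⇔Sz (sound C z∈ws)) y⇔z

  extend-path : ∀ {ws z y} → ClosedCycle ws → z ∈ ws → EqClosure Step z y → Extension ws y
  extend-path C z∈ws ε = _ , C , id , z∈ws
  extend-path C z∈ws (step ◅ path)
    with ws′ , C′ , ws⊆ws′ , x∈ws′ ← extend-step C z∈ws step
    with ws″ , C″ , ws′⊆ws″ , y∈ws″ ← extend-path C′ x∈ws′ path =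
    ws″ , C″ , ws′⊆ws″ ∘ ws⊆ws′ , y∈ws″

  module _ (connected : ∀ {x y} → S x → S y → EqClosure Step x y) where

    extend-all : ∀ {ws z} → ClosedCycle ws → z ∈ ws → ∀ ys → (∀ {y} → y ∈ ys → S y) →
                 ∃ λ ws′ → ClosedCycle ws′ × ws ⊆ ws′ × ys ⊆ ws′
    extend-all C z∈ws []       _     = _ , C , id , λ ()
    extend-all C z∈ws (y ∷ ys) sound′
      with ws′ , C′ , ws⊆ws′ , y∈ws′ ← extend-path C z∈ws (connected (sound C z∈ws) (sound′ (here refl)))
      with ws″ , C″ , ws′⊆ws″ , ys⊆ws″ ← extend-all C′ y∈ws′ ys (sound′ ∘ there) =
      ws″ , C″ , ws′⊆ws″ ∘ ws⊆ws′
      , λ { (here refl) → ws′⊆ws″ y∈ws′ ; (there y∈ys) → ys⊆ws″ y∈ys }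

    -- The orbit of the first element is the seed, and the other elements are reached from it one by
    -- one along paths of steps.
    exhaustive-cycle : ∀ ys → (∀ {y} → y ∈ ys → S y) → ∃ λ ws → ClosedCycle ws × ys ⊆ ws
    exhaustive-cycle [] _ =
      [] , record { unique = [] ; sound = λ () ; cyclic = [] ; closed = λ () } , λ ()
    exhaustive-cycle (y ∷ ys) sound′
      with ws , C , orbit⊆ws , ys⊆ws ← extend-all (Orbit.orbit-cycle y (sound′ (here refl))) (here refl) ys (sound′ ∘ there) =
      ws , C , λ { (here refl) → orbit⊆ws (here refl) ; (there y∈ys) → ys⊆ws y∈ys }

-- Rotating lists and words.

rotateList : {A : Set} → List A → List A
rotateList []       = []
rotateList (x ∷ xs) = xs ++ [ x ]

-- The induction needs `ys` to vary, since each rotation appends the head of `xs` to it.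
fold-rotateList-++ : {A : Set} (xs ys : List A) →
                     fold (xs ++ ys) rotateList (length xs) ≡ ys ++ xs
fold-rotateList-++ []       ys = sym (++-identityʳ ys)
fold-rotateList-++ (x ∷ xs) ys = begin
  fold (x ∷ xs ++ ys) rotateList (suc (length xs)) ≡⟨ fold-suc rotateList (x ∷ xs ++ ys) (length xs) ⟩
  fold ((xs ++ ys) ++ [ x ]) rotateList (length xs) ≡⟨ cong (λ v → fold v rotateList (length xs)) (++-assoc xs ys [ x ]) ⟩
  fold (xs ++ ys ++ [ x ]) rotateList (length xs)   ≡⟨ fold-rotateList-++ xs (ys ++ [ x ]) ⟩
  (ys ++ [ x ]) ++ xs                               ≡⟨ ++-assoc ys [ x ] xs ⟩
  ys ++ x ∷ xs                                      ∎
  where open ≡-Reasoning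

rotate : {A : Set} {n : ℕ} → Vec A n → Vec A n
rotate []       = []
rotate (x ∷ xs) = xs ∷ʳ x

module _ {A : Set} {n : ℕ} where

  toList-inj : {x y : Vec A n} → toList x ≡ toList y → x ≡ y
  toList-inj {x} {y} eq = trans (sym (cast-is-id refl x)) (toList-injective refl x y eq)

  toList-rotate : (x : Vec A n) → toList (rotate x) ≡ rotateList (toList x)
  toList-rotate []       = refl
  toList-rotate (a ∷ xs) = toList-∷ʳ a xs

  toList-fold-rotate : (x : Vec A n) → ∀ j → toList (fold x rotate j) ≡ fold (toList x) rotateList j
  toList-fold-rotate x zero    = refl
  toList-fold-rotate x (suc j) =
    trans (toList-rotate (fold x rotate j)) (cong rotateList (toList-fold-rotate x j))

  fold-rotate : (x : Vec A n) → ∀ {j} → j ≤ n →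
                toList (fold x rotate j) ≡ drop j (toList x) ++ take j (toList x)
  fold-rotate x {j} j≤n = begin
    toList (fold x rotate j) ≡⟨ toList-fold-rotate x j ⟩
    fold X rotateList j      ≡⟨ cong₂ (λ v → fold v rotateList) (take++drop≡id j X) ∣take∣ ⟨
    fold (take j X ++ drop j X) rotateList (length (take j X)) ≡⟨ fold-rotateList-++ (take j X) (drop j X) ⟩
    drop j X ++ take j X     ∎
    where
    open ≡-Reasoning
    X = toList x
    ∣take∣ : length (take j X) ≡ j
    ∣take∣ = trans (length-take j X) (trans (cong (j ⊓_) (length-toList x)) (m≤n⇒m⊓n≡m j≤n))

  fold-rotate-n : (x : Vec A n) → fold x rotate n ≡ x
  fold-rotate-n x = toList-inj (begin
    toList (fold x rotate n)              ≡⟨ fold-rotate x ≤-refl ⟩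
    drop n X ++ take n X                  ≡⟨ cong₂ _++_ (List.drop-all n X ∣X∣≤n) (List.take-all n X ∣X∣≤n) ⟩
    X                                     ∎)
    where
    open ≡-Reasoning
    X = toList x
    ∣X∣≤n = ≤-reflexive (length-toList x)

  fold-rotate-*n : (x : Vec A n) → ∀ e → fold x rotate (e * n) ≡ x
  fold-rotate-*n x zero    = refl
  fold-rotate-*n x (suc e) = begin
    fold x rotate (n + e * n)               ≡⟨ fold-+ x rotate n ⟩
    fold (fold x rotate (e * n)) rotate n   ≡⟨ fold-rotate-n _ ⟩
    fold x rotate (e * n)                   ≡⟨ fold-rotate-*n x e ⟩
    x                                       ∎
    where open ≡-Reasoning

-- Weights and exchanges between adjacent letters.

letterSum : ∀ {m} → List (Fin m) → ℕ
letterSum xs = sum (List.map toℕ xs)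

module _ {m : ℕ} where

  wt-toList : ∀ {n} (x : Word m n) → wt x ≡ letterSum (toList x)
  wt-toList []       = refl
  wt-toList (a ∷ xs) = cong (toℕ a +_) (wt-toList xs)

  letterSum-++ : (xs ys : List (Fin m)) → letterSum (xs ++ ys) ≡ letterSum xs + letterSum ys
  letterSum-++ xs ys = trans (cong sum (map-++ toℕ xs ys)) (sum-++ (List.map toℕ xs) (List.map toℕ ys))

  wt-rotate : ∀ {n} (x : Word m n) → wt (rotate x) ≡ wt x
  wt-rotate []       = refl
  wt-rotate (a ∷ xs) = begin
    wt (xs ∷ʳ a)                       ≡⟨ wt-toList (xs ∷ʳ a) ⟩
    letterSum (toList (xs ∷ʳ a))       ≡⟨ cong letterSum (toList-∷ʳ a xs) ⟩
    letterSum (toList xs ++ [ a ])     ≡⟨ letterSum-++ (toList xs) [ a ] ⟩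
    letterSum (toList xs) + (toℕ a + 0) ≡⟨ cong₂ _+_ (wt-toList xs) (sym (+-identityʳ (toℕ a))) ⟨
    wt xs + toℕ a                      ≡⟨ +-comm (wt xs) (toℕ a) ⟩
    toℕ a + wt xs                      ∎
    where open ≡-Reasoning

  wt-fold-rotate : ∀ {n} (x : Word m n) j → wt (fold x rotate j) ≡ wt x
  wt-fold-rotate x zero    = refl
  wt-fold-rotate x (suc j) = trans (wt-rotate (fold x rotate j)) (wt-fold-rotate x j)

  data Exchange : ∀ {n} → Word m n → Word m n → Set where
    here  : ∀ {n a b a′ b′} {xs : Word m n} → toℕ a + toℕ b ≡ toℕ a′ + toℕ b′ →
            Exchange (a ∷ b ∷ xs) (a′ ∷ b′ ∷ xs)
    there : ∀ {n a} {xs ys : Word m n} → Exchange xs ys → Exchange (a ∷ xs) (a ∷ ys)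

  Exchange-sym : ∀ {n} {x y : Word m n} → Exchange x y → Exchange y x
  Exchange-sym (here eq) = here (sym eq)
  Exchange-sym (there e) = there (Exchange-sym e)

  Exchange-wt : ∀ {n} {x y : Word m n} → Exchange x y → wt x ≡ wt y
  Exchange-wt (here {a = a} {b} {a′} {b′} {xs} eq) = begin
    toℕ a + (toℕ b + wt xs)   ≡⟨ +-assoc (toℕ a) (toℕ b) (wt xs) ⟨
    toℕ a + toℕ b + wt xs     ≡⟨ cong (_+ wt xs) eq ⟩
    toℕ a′ + toℕ b′ + wt xs   ≡⟨ +-assoc (toℕ a′) (toℕ b′) (wt xs) ⟩
    toℕ a′ + (toℕ b′ + wt xs) ∎
    where open ≡-Reasoning
  Exchange-wt (there {a = a} e) = cong (toℕ a +_) (Exchange-wt e)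

  Exchange⋆-wt : ∀ {n} {x y : Word m n} → Star Exchange x y → wt x ≡ wt y
  Exchange⋆-wt ε        = refl
  Exchange⋆-wt (e ◅ es) = trans (Exchange-wt e) (Exchange⋆-wt es)

  -- The unit comes from the first nonzero letter of the tail and is carried to the head one
  -- position at a time.
  raise-head : ∀ {n} {a b : Fin m} (xs : Word m n) → toℕ b ≡ suc (toℕ a) → 1 ≤ wt xs →
               ∃ λ ys → Star Exchange (a ∷ xs) (b ∷ ys)
  raise-head {a = a} {b} (c ∷ xs) b≡1+a 1≤wt with toℕ c in c≡
  ... | suc c′ = fromℕ< c′<m ∷ xs , here eq ◅ ε
    where
    c′<m : c′ < m
    c′<m = <-trans (n<1+n c′) (subst (_< m) c≡ (toℕ<n c))
    eq : toℕ a + toℕ c ≡ toℕ b + toℕ (fromℕ< c′<m)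
    eq = begin
      toℕ a + toℕ c                ≡⟨ cong (toℕ a +_) c≡ ⟩
      toℕ a + suc c′               ≡⟨ +-suc (toℕ a) c′ ⟩
      suc (toℕ a) + c′             ≡⟨ cong₂ _+_ (sym b≡1+a) (sym (toℕ-fromℕ< c′<m)) ⟩
      toℕ b + toℕ (fromℕ< c′<m)    ∎
      where open ≡-Reasoning
  -- The neighbour has nothing to give, so it is first raised to 1 and then passes that unit on. The
  -- letter 1 exists because `b` is a positive letter.
  ... | zero =
    let ys , path = raise-head xs one≡ 1≤wt
    in c ∷ ys , Star.gmap (a ∷_) there path ◅◅ here eq ◅ ε
    where
    1<m : 1 < m
    1<m = ≤-<-trans (s≤s z≤n) (subst (_< m) b≡1+a (toℕ<n b))
    one≡ : toℕ (fromℕ< 1<m) ≡ suc (toℕ c)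
    one≡ = trans (toℕ-fromℕ< 1<m) (cong suc (sym c≡))
    eq : toℕ a + toℕ (fromℕ< 1<m) ≡ toℕ b + toℕ c
    eq = begin
      toℕ a + toℕ (fromℕ< 1<m) ≡⟨ cong (toℕ a +_) one≡ ⟩
      toℕ a + suc (toℕ c)      ≡⟨ +-suc (toℕ a) (toℕ c) ⟩
      suc (toℕ a) + toℕ c      ≡⟨ cong (_+ toℕ c) (sym b≡1+a) ⟩
      toℕ b + toℕ c            ∎
      where open ≡-Reasoning

  raise-head-by : ∀ δ {n} {a b : Fin m} (xs : Word m n) → toℕ b ≡ δ + toℕ a → δ ≤ wt xs →
                  ∃ λ ys → Star Exchange (a ∷ xs) (b ∷ ys)
  raise-head-by zero xs b≡a _ with refl ← toℕ-injective b≡a = xs , ε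
  raise-head-by (suc δ) {a = a} {b} xs b≡ δ<wt =
    let c = fromℕ< 1+a<m
        ys , path  = raise-head {b = c} xs c≡ (≤-trans (s≤s z≤n) δ<wt)
        zs , path′ = raise-head-by δ {a = c} {b} ys b≡′ (δ≤wt path)
    in zs , path ◅◅ path′
    where
    open ≡-Reasoning
    1+a<m : suc (toℕ a) < m
    1+a<m = ≤-<-trans (≤-trans (s≤s (m≤n+m (toℕ a) δ)) (≤-reflexive (sym b≡))) (toℕ<n b)
    c≡ : toℕ (fromℕ< 1+a<m) ≡ suc (toℕ a)
    c≡ = toℕ-fromℕ< 1+a<m
    b≡′ : toℕ b ≡ δ + toℕ (fromℕ< 1+a<m)
    b≡′ = trans b≡ (trans (sym (+-suc δ (toℕ a))) (cong (δ +_) (sym c≡)))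
    -- Weight is preserved and the head has gained one, so the tail has lost just one of its at
    -- least `suc δ` units.
    δ≤wt : ∀ {ys} → Star Exchange (a ∷ xs) (fromℕ< 1+a<m ∷ ys) → δ ≤ wt ys
    δ≤wt {ys} path = s≤s⁻¹ (≤-trans δ<wt (≤-reflexive (+-cancelˡ-≡ (toℕ a) _ _ (begin
      toℕ a + wt xs                ≡⟨ Exchange⋆-wt path ⟩
      toℕ (fromℕ< 1+a<m) + wt ys   ≡⟨ cong (_+ wt ys) c≡ ⟩
      suc (toℕ a) + wt ys          ≡⟨ +-suc (toℕ a) (wt ys) ⟨
      toℕ a + suc (wt ys)          ∎))))

  mutual
    -- The smaller head is raised to the larger one; the tails then have equal weight and the
    -- recursion continues on them. Reversing paths reduces everything to `ordered-heads`.
    equal-wt⇒Exchange⋆ : ∀ {n} (x y : Word m n) → wt x ≡ wt y → Star Exchange x y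
    equal-wt⇒Exchange⋆ []       []       _  = ε
    equal-wt⇒Exchange⋆ (a ∷ xs) (b ∷ ys) eq with ≤-total (toℕ a) (toℕ b)
    ... | inj₁ a≤b = ordered-heads a≤b xs ys eq
    ... | inj₂ b≤a = Star.reverse Exchange-sym (ordered-heads b≤a ys xs (sym eq))

    ordered-heads : ∀ {n} {a b : Fin m} → toℕ a ≤ toℕ b → (xs ys : Word m n) →
                    wt (a ∷ xs) ≡ wt (b ∷ ys) → Star Exchange (a ∷ xs) (b ∷ ys)
    ordered-heads {a = a} {b} a≤b xs ys eq =
      let δ = toℕ b ∸ toℕ a
          b≡δ+a : toℕ b ≡ δ + toℕ a
          b≡δ+a = sym (m∸n+n≡m a≤b)
          wt-xs : wt xs ≡ δ + wt ys
          wt-xs = +-cancelˡ-≡ (toℕ a) _ _ (begin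
            toℕ a + wt xs       ≡⟨ eq ⟩
            toℕ b + wt ys       ≡⟨ cong (_+ wt ys) (trans b≡δ+a (+-comm δ (toℕ a))) ⟩
            toℕ a + δ + wt ys   ≡⟨ +-assoc (toℕ a) δ (wt ys) ⟩
            toℕ a + (δ + wt ys) ∎)
          zs , path = raise-head-by δ xs b≡δ+a (≤-trans (m≤m+n δ (wt ys)) (≤-reflexive (sym wt-xs)))
          wt-zs : wt zs ≡ wt ys
          wt-zs = +-cancelˡ-≡ (toℕ b) _ _ (trans (sym (Exchange⋆-wt path)) eq)
      in path ◅◅ Star.gmap (b ∷_) there (equal-wt⇒Exchange⋆ zs ys wt-zs)
      where open ≡-Reasoning

  -- The index `i` counts the letters before the altered pair. It is what `window` takes in order to
  -- bring the pair among the first `d` letters.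
  Exchange-position : ∀ {n} {x y : Word m n} → Exchange x y →
    ∃ λ i → 2 + i ≤ n × take i (toList x) ≡ take i (toList y)
          × drop (2 + i) (toList x) ≡ drop (2 + i) (toList y)
  Exchange-position (here _) = 0 , s≤s (s≤s z≤n) , refl , refl
  Exchange-position (there {a = a} e) with i , 2+i≤n , takes , drops ← Exchange-position e =
    suc i , s≤s 2+i≤n , cong (a ∷_) takes , drops

  words : ∀ n → List (Word m n)
  words zero    = [] ∷ []
  words (suc n) = cartesianProductWith _∷_ (allFin m) (words n)

  ∈-words : ∀ {n} (x : Word m n) → x ∈ words n
  ∈-words []       = here refl
  ∈-words (a ∷ xs) = ∈-cartesianProductWith⁺ _∷_ (∈-allFin a) (∈-words xs)

-- The multiples N * d below n give disjoint windows; a pair i, i + 1 straddling two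
-- of them is covered by the windows of the second pass around the word, which
-- start at offset d ∸ n % d.
window : ∀ {d n} → ¬ d ∣ n → .{{NonZero d}} → ∀ i →
         ∃ λ j → ∃₂ λ N e → j ≤ i × 2 + i ≤ j + d × N * d ≡ j + e * n
window {d} {n} d∤n i with 2 + i % d ≤? d
... | yes 2+v≤d = u * d , u , 0
    , ≤-trans (m≤n+m (u * d) v) (≤-reflexive (sym i≡))
    , (begin
        2 + i             ≡⟨ cong (2 +_) i≡ ⟩
        2 + v + u * d     ≤⟨ +-monoˡ-≤ (u * d) 2+v≤d ⟩
        d + u * d         ≡⟨ +-comm d (u * d) ⟩
        u * d + d         ∎)
    , sym (+-identityʳ (u * d))
  where
  open ≤-Reasoning
  u = i / d
  v = i % d
  i≡ : i ≡ v + u * d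
  i≡ = m≡m%n+[m/n]*n i d
... | no 2+v≰d = u * d + c , q + suc u , 1
    , s≤s⁻¹ (begin
        suc (u * d + c)   ≡⟨ +-suc (u * d) c ⟨
        u * d + suc c     ≤⟨ +-monoʳ-≤ (u * d) 1+c≤d ⟩
        u * d + d         ≡⟨ 1+i≡ ⟨
        suc i             ∎)
    , (begin
        2 + i             ≡⟨ cong suc 1+i≡ ⟩
        suc (u * d) + d   ≡⟨ cong (_+ d) (+-comm 1 (u * d)) ⟩
        u * d + 1 + d     ≤⟨ +-monoˡ-≤ d (+-monoʳ-≤ (u * d) (m<n⇒0<n∸m r<d)) ⟩
        u * d + c + d     ∎)
    , trans
        (solve 3 (λ q u d → (q :+ (con 1 :+ u)) :* d := u :* d :+ (d :+ q :* d)) refl q u d)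
        (trans (cong (λ x → u * d + (x + q * d)) d≡)
          (trans (solve 4 (λ q x c r → x :+ (c :+ r :+ q) := x :+ c :+ (r :+ q :+ con 0)) refl (q * d) (u * d) c r)
            (cong (λ x → u * d + c + (x + 0)) (sym (m≡m%n+[m/n]*n n d)))))
  where
  open ≤-Reasoning
  open +-*-Solver
  u = i / d
  v = i % d
  q = n / d
  r = n % d
  c = d ∸ r
  r<d : r < d
  r<d = m%n<n n d
  d≡ : d ≡ c + r
  d≡ = sym (m∸n+n≡m (<⇒≤ r<d))
  0<r : 0 < r
  0<r = n≢0⇒n>0 (λ r≡0 → d∤n (m%n≡0⇒n∣m n d r≡0))
  1+c≤d : suc c ≤ d
  1+c≤d = ≤-trans (≤-reflexive (+-comm 1 c)) (≤-trans (+-monoʳ-≤ c 0<r) (≤-reflexive (sym d≡)))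
  1+v≡d : suc v ≡ d
  1+v≡d = ≤-antisym (m%n<n i d) (s≤s⁻¹ (≰⇒> 2+v≰d))
  1+i≡ : suc i ≡ u * d + d
  1+i≡ = trans (cong suc (m≡m%n+[m/n]*n i d))
           (trans (cong (_+ u * d) 1+v≡d) (+-comm d (u * d)))

-- Agreement of lists under `take` and `drop`.

drop-++-cong : {A : Set} (xs xs′ ys : List A) → length xs ≡ length xs′ → ∀ j →
               drop j xs ≡ drop j xs′ → drop j (xs ++ ys) ≡ drop j (xs′ ++ ys)
drop-++-cong xs       xs′        ys eq zero    ds = cong (_++ ys) ds
drop-++-cong []       []         ys eq (suc j) ds = refl
drop-++-cong (x ∷ xs) (x′ ∷ xs′) ys eq (suc j) ds = drop-++-cong xs xs′ ys (suc-injective eq) j ds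

take-++ˡ : {A : Set} (xs ys : List A) → take (length xs) (xs ++ ys) ≡ xs
take-++ˡ []       ys = refl
take-++ˡ (x ∷ xs) ys = cong (x ∷_) (take-++ˡ xs ys)

drop-≤ : {A : Set} {i j : ℕ} → i ≤ j → (xs ys : List A) →
         drop i xs ≡ drop i ys → drop j xs ≡ drop j ys
drop-≤ {i = i} i≤j xs ys eq with k , refl ← m≤n⇒∃[o]m+o≡n i≤j =
  trans (sym (drop-drop i k xs)) (trans (cong (drop k) eq) (drop-drop i k ys))

take-≤ : {A : Set} {i j : ℕ} → j ≤ i → (xs ys : List A) →
         take i xs ≡ take i ys → take j xs ≡ take j ys
take-≤ {i = i} {j} j≤i xs ys eq = trans (shorten xs) (trans (cong (take j) eq) (sym (shorten ys)))
  where
  shorten : ∀ zs → take j zs ≡ take j (take i zs)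
  shorten zs = sym (trans (List.take-take j i zs) (cong (λ k → take k zs) (m≤n⇒m⊓n≡m j≤i)))

-- Sufficiency: connecting words of equal weight.

module Sufficiency {m n s : ℕ} (k : ℕ) (s<n : s < n) (d∤n : ¬ (n ∸ s) ∣ n) where

  private
    d = n ∸ s

    instance
      d-nonZero : NonZero d
      d-nonZero = >-nonZero (m<n⇒0<n∸m s<n)

    d≤n : d ≤ n
    d≤n = m∸n≤m n s

  π : Word m n → Word m n
  π x = fold x rotate d

  fold-π : ∀ x N → fold x π N ≡ fold x rotate (N * d)
  fold-π x zero    = refl
  fold-π x (suc N) = trans (cong π (fold-π x N)) (sym (fold-+ x rotate d))

  -- Read from right to left, this is the overlap that lets `π x` follow `x`.
  take-π : ∀ x → take s (toList (π x)) ≡ drop d (toList x)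
  take-π x = begin
    take s (toList (π x))                ≡⟨ cong₂ take ∣drop∣ (sym (fold-rotate x d≤n)) ⟨
    take (length (drop d X)) (drop d X ++ take d X) ≡⟨ take-++ˡ (drop d X) (take d X) ⟩
    drop d X                             ∎
    where
    open ≡-Reasoning
    X = toList x
    ∣drop∣ : length (drop d X) ≡ s
    ∣drop∣ = trans (length-drop d X) (trans (cong (_∸ d) (length-toList x)) (m∸[m∸n]≡n (<⇒≤ s<n)))

  -- Rotating by `n * d` letters makes `d` full turns.
  π-periodic : ∀ x → fold x π n ≡ x
  π-periodic x = begin
    fold x π n             ≡⟨ fold-π x n ⟩
    fold x rotate (n * d)  ≡⟨ cong (fold x rotate) (*-comm n d) ⟩
    fold x rotate (d * n)  ≡⟨ fold-rotate-*n x d ⟩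
    x                      ∎
    where open ≡-Reasoning

  π-wt : ∀ x → wt (π x) ≡ wt x
  π-wt x = wt-fold-rotate x d

  suc-pred-n : suc (pred n) ≡ n
  suc-pred-n = suc-pred n {{>-nonZero (≤-<-trans z≤n s<n)}}

  open CycleJoining (≡-dec Fin._≟_) (Overlap s) (𝓑 k m n) π (pred n)
    (λ x → trans (cong (fold x π) suc-pred-n) (π-periodic x))
    (λ x → sym (take-π x))
    (λ {x} wt≡k → trans (π-wt x) wt≡k)

  step-fold-π : ∀ x N → EqClosure Step x (fold x π N)
  step-fold-π x zero    = ε
  step-fold-π x (suc N) = step-fold-π x N ◅◅ Eq.return (rotated refl)

  -- Whether `x` may follow a word depends only on the first `s` letters of `x`.
  same-prefix⇒Step : ∀ x y → wt x ≡ wt y → take s (toList x) ≡ take s (toList y) → Step x y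
  same-prefix⇒Step x y wt≡ prefix≡ =
    exchangeable (mk⇔ (trans (sym wt≡)) (trans wt≡))
                (mk⇔ (λ o → trans o prefix≡) (λ o → trans o (sym prefix≡)))

  -- One application of `π` brings the last `s` letters to the front, where equal tails become equal
  -- prefixes; afterwards the rotation is undone.
  same-tail⇒Steps : ∀ x y → wt x ≡ wt y → drop d (toList x) ≡ drop d (toList y) → EqClosure Step x y
  same-tail⇒Steps x y wt≡ tail≡ =
    step-fold-π x 1
    ◅◅ Eq.return (same-prefix⇒Step (π x) (π y) (trans (π-wt x) (trans wt≡ (sym (π-wt y))))
         (trans (take-π x) (trans tail≡ (sym (take-π y)))))
    ◅◅ Eq.symmetric Step (step-fold-π y 1)

  Exchange⇒Steps : ∀ {x y} → Exchange x y → EqClosure Step x y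
  Exchange⇒Steps {x} {y} e
    with i , 2+i≤n , takes , drops ← Exchange-position e
    with j , N , c , j≤i , 2+i≤j+d , eq ← window {d} {n} d∤n i =
    to-window x ◅◅ same-tail⇒Steps _ _ wt≡ tail≡ ◅◅ Eq.symmetric Step (to-window y)
    where
    X = toList x
    Y = toList y

    j≤n : j ≤ n
    j≤n = ≤-trans j≤i (≤-trans (m≤n+m i 2) 2+i≤n)

    -- The `N` applications of `π` rotate by `j + c * n` letters in all, and the `c` full turns have
    -- no effect.
    to-window : ∀ z → EqClosure Step z (fold z rotate j)
    to-window z = subst (EqClosure Step z) (begin
      fold z π N                            ≡⟨ fold-π z N ⟩
      fold z rotate (N * d)                 ≡⟨ cong (fold z rotate) eq ⟩
      fold z rotate (j + c * n)             ≡⟨ fold-+ z rotate j ⟩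
      fold (fold z rotate (c * n)) rotate j ≡⟨ cong (λ v → fold v rotate j) (fold-rotate-*n z c) ⟩
      fold z rotate j                       ∎) (step-fold-π z N)
      where open ≡-Reasoning

    wt≡ : wt (fold x rotate j) ≡ wt (fold y rotate j)
    wt≡ = trans (wt-fold-rotate x j) (trans (Exchange-wt e) (sym (wt-fold-rotate y j)))

    ∣drop∣≡ : length (drop j X) ≡ length (drop j Y)
    ∣drop∣≡ = trans (length-drop j X) (trans (cong (_∸ j) (trans (length-toList x) (sym (length-toList y))))
                (sym (length-drop j Y)))

    -- After rotation by `j` the altered pair lies within the first `d` letters: the `j` letters
    -- moved to the end precede it, and those from position `j + d` on follow it. If `j + d` exceeds
    -- `n`, the window wraps around into the moved letters, which `drop-++-cong` allows.
    tail≡ : drop d (toList (fold x rotate j)) ≡ drop d (toList (fold y rotate j))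
    tail≡ = begin
      drop d (toList (fold x rotate j)) ≡⟨ cong (drop d) (fold-rotate x j≤n) ⟩
      drop d (drop j X ++ take j X)     ≡⟨ cong (λ v → drop d (drop j X ++ v)) (take-≤ j≤i X Y takes) ⟩
      drop d (drop j X ++ take j Y)     ≡⟨ drop-++-cong (drop j X) (drop j Y) (take j Y) ∣drop∣≡ d
                                             (trans (drop-drop j d X) (trans (drop-≤ 2+i≤j+d X Y drops) (sym (drop-drop j d Y)))) ⟩
      drop d (drop j Y ++ take j Y)     ≡⟨ cong (drop d) (fold-rotate y j≤n) ⟨
      drop d (toList (fold y rotate j)) ∎
      where open ≡-Reasoning

  connected : ∀ {x y} → wt x ≡ k → wt y ≡ k → EqClosure Step x y
  connected wtx wty =
    Star.concat (Star.map Exchange⇒Steps (equal-wt⇒Exchange⋆ _ _ (trans wtx (sym wty))))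

  ocycle : HasOcycle s (𝓑 k m n)
  ocycle = ws , record
    { unique     = ClosedCycle.unique C
    ; enumerates = λ x → mk⇔ (ClosedCycle.sound C) (λ wt≡k → ys⊆ws (∈-filter⁺ wt≟k (∈-words x) wt≡k))
    ; overlaps   = ClosedCycle.cyclic C
    }
    where
    wt≟k = λ (x : Word m n) → wt x ≟ k
    ys = filter wt≟k (words n)
    covering = exhaustive-cycle connected ys (λ y∈ → proj₂ (∈-filter⁻ wt≟k {xs = words n} y∈))
    ws = proj₁ covering
    C = proj₁ (proj₂ covering)
    ys⊆ws = proj₂ (proj₂ covering)

-- Necessity: weights of consecutive blocks.

letters : ∀ {m n} → Word m n → List ℕ
letters x = List.map toℕ (toList x)

-- Greedy choice: each letter takes `m ⊓ w` and leaves `w ∸ m` to the rest.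
fill : ∀ m n w → w ≤ n * m → ∃ λ (x : Word (suc m) n) → wt x ≡ w
fill m zero    zero _ = [] , refl
fill m (suc n) w w≤ =
  let x , wt≡ = fill m n (w ∸ m) (≤-trans (∸-monoˡ-≤ m w≤) (≤-reflexive (m+n∸m≡n m (n * m))))
  in fromℕ< (s≤s (m⊓n≤m m w)) ∷ x
   , trans (cong₂ _+_ (toℕ-fromℕ< (s≤s (m⊓n≤m m w))) wt≡) (m⊓n+n∸m≡n m w)

take-++ : {A : Set} → ∀ {n} (xs ys : List A) → n ≤ length xs → take n (xs ++ ys) ≡ take n xs
take-++ {n = zero}  xs       ys _       = refl
take-++ {n = suc n} (x ∷ xs) ys (s≤s l) = cong (x ∷_) (take-++ xs ys l)

drop-++ : {A : Set} → ∀ {n} (xs ys : List A) → n ≤ length xs → drop n (xs ++ ys) ≡ drop n xs ++ ys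
drop-++ {n = zero}  xs       ys _       = refl
drop-++ {n = suc n} (x ∷ xs) ys (s≤s l) = drop-++ xs ys l

module _ {m : ℕ} (d : ℕ) where

  blockSums : ℕ → List (Fin m) → List ℕ
  blockSums zero    xs = []
  blockSums (suc q) xs = letterSum (take d xs) ∷ blockSums q (drop d xs)

  blockSums-∷ʳ : ∀ q xs ys → length xs ≡ q * d → length ys ≡ d →
                 blockSums (suc q) (xs ++ ys) ≡ blockSums q xs ++ [ letterSum ys ]
  blockSums-∷ʳ zero    [] ys _     ∣ys∣ = cong (λ v → letterSum v ∷ []) (List.take-all d ys (≤-reflexive ∣ys∣))
  blockSums-∷ʳ (suc q) xs ys ∣xs∣ ∣ys∣ = cong₂ _∷_
    (cong letterSum (take-++ xs ys d≤∣xs∣))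
    (trans (cong (blockSums (suc q)) (drop-++ xs ys d≤∣xs∣))
           (blockSums-∷ʳ q (drop d xs) ys
              (trans (length-drop d xs) (trans (cong (_∸ d) ∣xs∣) (m+n∸m≡n d (q * d)))) ∣ys∣))
    where
    d≤∣xs∣ : d ≤ length xs
    d≤∣xs∣ = ≤-trans (m≤m+n d (q * d)) (≤-reflexive (sym ∣xs∣))

  letterSum-split : ∀ j (xs : List (Fin m)) → letterSum xs ≡ letterSum (take j xs) + letterSum (drop j xs)
  letterSum-split j xs = trans (cong letterSum (sym (take++drop≡id j xs))) (letterSum-++ (take j xs) (drop j xs))

  -- The overlap identifies the last `q` blocks of `x` with the first `q` blocks of `y`. The two
  -- blocks left over, the first of `x` and the last of `y`, then have equal sums because the total
  -- weights agree.
  overlap-rotates-blockSums : ∀ {q} (x y : Word m (suc q * d)) → wt x ≡ wt y → Overlap (q * d) x y →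
    ∃₂ λ b bs → blockSums (suc q) (toList x) ≡ b ∷ bs × blockSums (suc q) (toList y) ≡ bs ++ [ b ]
  overlap-rotates-blockSums {q} x y wt≡ x▹y =
    letterSum (take d X) , blockSums q (drop d X) , refl , (begin
      blockSums (suc q) Y                                ≡⟨ cong (blockSums (suc q)) (take++drop≡id s Y) ⟨
      blockSums (suc q) (take s Y ++ drop s Y)           ≡⟨ blockSums-∷ʳ q (take s Y) (drop s Y) ∣take∣ ∣drop∣ ⟩
      blockSums q (take s Y) ++ [ letterSum (drop s Y) ] ≡⟨ cong₂ (λ v w → blockSums q v ++ [ w ]) overlap′ ends ⟨
      blockSums q (drop d X) ++ [ letterSum (take d X) ] ∎)
    where
    open ≡-Reasoning
    s = q * d
    X = toList x
    Y = toList y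
    overlap′ : drop d X ≡ take s Y
    overlap′ = trans (cong (λ j → drop j X) (sym (m+n∸n≡m d s))) x▹y
    ∣take∣ : length (take s Y) ≡ s
    ∣take∣ = trans (length-take s Y) (trans (cong (s ⊓_) (length-toList y)) (m≤n⇒m⊓n≡m (m≤n+m s d)))
    ∣drop∣ : length (drop s Y) ≡ d
    ∣drop∣ = trans (length-drop s Y) (trans (cong (_∸ s) (length-toList y)) (m+n∸n≡m d s))
    ends : letterSum (take d X) ≡ letterSum (drop s Y)
    ends = +-cancelʳ-≡ (letterSum (take s Y)) _ _ (begin
      letterSum (take d X) + letterSum (take s Y) ≡⟨ cong (λ v → letterSum (take d X) + letterSum v) overlap′ ⟨
      letterSum (take d X) + letterSum (drop d X) ≡⟨ letterSum-split d X ⟨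
      letterSum X                                 ≡⟨ wt-toList x ⟨
      wt x                                        ≡⟨ wt≡ ⟩
      wt y                                        ≡⟨ wt-toList y ⟩
      letterSum Y                                 ≡⟨ letterSum-split s Y ⟩
      letterSum (take s Y) + letterSum (drop s Y) ≡⟨ +-comm (letterSum (take s Y)) _ ⟩
      letterSum (drop s Y) + letterSum (take s Y) ∎)

wt-++ : ∀ {m i j} (x : Word m i) (y : Word m j) → wt (x Vec.++ y) ≡ wt x + wt y
wt-++ []       y = refl
wt-++ (a ∷ xs) y = trans (cong (toℕ a +_) (wt-++ xs y)) (sym (+-assoc (toℕ a) (wt xs) (wt y)))

-- A block of `d` letters, each at most `m`, attains every sum up to `d * m`. Sequences of block
-- sums are therefore treated as words over the alphabet of size `suc (d * m)`.
realise-blockSums : ∀ m d {q} (u : Word (suc (d * m)) q) →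
  ∃ λ (x : Word (suc m) (q * d)) → blockSums d q (toList x) ≡ letters u × wt x ≡ wt u
realise-blockSums m d []       = [] , refl , refl
realise-blockSums m d {suc q} (a ∷ us)
  with x , wt-x≡a ← fill m d (toℕ a) (toℕ≤pred[n] a)
  with y , sums , wt-y≡ ← realise-blockSums m d us =
  x Vec.++ y
  , cong₂ _∷_
      (trans (cong letterSum take≡) (trans (sym (wt-toList x)) wt-x≡a))
      (trans (cong (blockSums d q) drop≡) sums)
  , trans (wt-++ x y) (cong₂ _+_ wt-x≡a wt-y≡)
  where
  X = toList x
  ∣X∣ : length X ≡ d
  ∣X∣ = length-toList x
  take≡ : take d (toList (x Vec.++ y)) ≡ X
  take≡ = trans (cong (take d) (toList-++ x y))
            (trans (take-++ X (toList y) (≤-reflexive (sym ∣X∣))) (List.take-all d X (≤-reflexive ∣X∣)))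
  drop≡ : drop d (toList (x Vec.++ y)) ≡ toList y
  drop≡ = trans (cong (drop d) (toList-++ x y))
            (trans (drop-++ X (toList y) (≤-reflexive (sym ∣X∣))) (cong (_++ toList y) (List.drop-all d X (≤-reflexive ∣X∣))))

-- Rotation invariants along an ocycle.

RotationInvariant : (List ℕ → ℕ) → Set
RotationInvariant f = ∀ a as → f (a ∷ as) ≡ f (as ++ [ a ])

module _ {A : Set} {R : A → A → Set} where

  Linked-++⁻-prefix : ∀ xs {ys} → Linked R (xs ++ ys) → Linked R xs
  Linked-++⁻-prefix []           _       = []
  Linked-++⁻-prefix (x ∷ [])     _       = [-]
  Linked-++⁻-prefix (x ∷ y ∷ xs) (r ∷ l) = r ∷ Linked-++⁻-prefix (y ∷ xs) l

  Linked-constant : (S : A → Set) (g : A → ℕ) → (∀ {x y} → S x → S y → R x y → g x ≡ g y) →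
                    ∀ {z zs} → (∀ {x} → x ∈ z ∷ zs → S x) → Linked R (z ∷ zs) →
                    ∀ {x} → x ∈ z ∷ zs → g x ≡ g z
  Linked-constant S g step sound l       (here refl) = refl
  Linked-constant S g step sound (r ∷ l) (there x∈)  =
    trans (Linked-constant S g step (sound ∘ there) l x∈)
          (sym (step (sound (here refl)) (sound (there (here refl))) r))

ocycle-constant : ∀ {m n s k} → HasOcycle s (𝓑 k m n) → (g : Word m n → ℕ) →
  (∀ {x y} → wt x ≡ k → wt y ≡ k → Overlap s x y → g x ≡ g y) →
  ∀ x y → wt x ≡ k → wt y ≡ k → g x ≡ g y
ocycle-constant {m} {n} {s} {k} (ws , isOcycle) g step x y wt-x wt-y =
  constant ws sound (Linked-++⁻-prefix ws overlaps)
    (Equivalence.from (enumerates x) wt-x) (Equivalence.from (enumerates y) wt-y)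
  where
  open IsOcycle isOcycle
  sound : ∀ {z} → z ∈ ws → wt z ≡ k
  sound {z} = Equivalence.to (enumerates z)
  constant : ∀ zs → (∀ {z} → z ∈ zs → wt z ≡ k) → Linked (Overlap s) zs → x ∈ zs → y ∈ zs → g x ≡ g y
  constant (z ∷ zs) sound′ l x∈ y∈ =
    trans (Linked-constant (λ v → wt v ≡ k) g step sound′ l x∈)
          (sym (Linked-constant (λ v → wt v ≡ k) g step sound′ l y∈))

-- The obstruction at the level of block sums: each letter of `u` and `v` stands for the weight of a
-- block.
record Distinguished (m q k : ℕ) : Set where
  field
    f         : List ℕ → ℕ
    invariant : RotationInvariant f
    {u v}     : Word m q
    wt-u      : wt u ≡ k
    wt-v      : wt v ≡ k
    differ    : f (letters u) ≢ f (letters v)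

-- Words with block sums `u` and `v` would both lie on the ocycle, along which `f` of the block sums
-- cannot change.
distinguished⇒¬ocycle : ∀ {m d q k} → Distinguished (suc (d * m)) (suc q) k →
                        ¬ HasOcycle (q * d) (𝓑 k (suc m) (suc q * d))
distinguished⇒¬ocycle {m} {d} {q} {k} D ocycle =
  let open Distinguished D
      x , sums-x , wt-x = realise-blockSums m d u
      y , sums-y , wt-y = realise-blockSums m d v
      g = λ (z : Word (suc m) (suc q * d)) → f (blockSums d (suc q) (toList z))
      step : ∀ {x y} → wt x ≡ k → wt y ≡ k → Overlap (q * d) x y → g x ≡ g y
      step = λ {x} {y} wt-x wt-y x▹y →
        let b , bs , sums-x , sums-y = overlap-rotates-blockSums d x y (trans wt-x (sym wt-y)) x▹y
        in trans (cong f sums-x) (trans (invariant b bs) (sym (cong f sums-y)))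
  in differ (trans (sym (cong f sums-x))
       (trans (ocycle-constant ocycle g step x y (trans wt-x wt-u) (trans wt-y wt-v))
              (cong f sums-y)))

-- Words separated by rotation invariants.

adjacentProducts : ℕ → List ℕ → ℕ → ℕ
adjacentProducts a []       e = a * e
adjacentProducts a (b ∷ bs) e = a * b + adjacentProducts b bs e

-- The last argument of `adjacentProducts` remembers the first entry, for the product that closes
-- the cycle.
cyclicProducts : List ℕ → ℕ
cyclicProducts []       = 0
cyclicProducts (a ∷ as) = adjacentProducts a as a

adjacentProducts-∷ʳ : ∀ a bs c e →
  adjacentProducts a (bs ++ [ c ]) e ≡ adjacentProducts a bs c + c * e
adjacentProducts-∷ʳ a []       c e = refl
adjacentProducts-∷ʳ a (b ∷ bs) c e =
  trans (cong (a * b +_) (adjacentProducts-∷ʳ b bs c e)) (sym (+-assoc (a * b) _ (c * e)))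

cyclicProducts-invariant : RotationInvariant cyclicProducts
cyclicProducts-invariant a []       = refl
cyclicProducts-invariant a (b ∷ bs) =
  trans (+-comm (a * b) _) (sym (adjacentProducts-∷ʳ b bs a b))

squares : List ℕ → ℕ
squares as = sum (List.map (λ a → a * a) as)

squares-invariant : RotationInvariant squares
squares-invariant a as = begin
  a * a + squares as                ≡⟨ +-comm (a * a) (squares as) ⟩
  squares as + a * a                ≡⟨ cong (squares as +_) (+-identityʳ (a * a)) ⟨
  squares as + squares [ a ]        ≡⟨ sum-++ (List.map (λ b → b * b) as) [ a * a ] ⟨
  sum (List.map (λ b → b * b) as ++ [ a * a ]) ≡⟨ cong sum (map-++ (λ b → b * b) as [ a ]) ⟨
  squares (as ++ [ a ])             ∎
  where open ≡-Reasoning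

-- For binary words the squares carry no information; 1100z and 1010z have
-- different cyclic products instead.
distinguished-binary : ∀ q k → 2 ≤ k → 2 + k ≤ q → Distinguished 2 q k
distinguished-binary (suc (suc (suc (suc q)))) (suc (suc k)) (s≤s (s≤s z≤n)) (s≤s (s≤s (s≤s (s≤s k≤q))))
  with z , wt-z ← fill 1 q k (≤-trans k≤q (≤-reflexive (sym (*-identityʳ q)))) = record
  { f         = cyclicProducts
  ; invariant = cyclicProducts-invariant
  ; u         = suc zero ∷ suc zero ∷ zero ∷ zero ∷ z
  ; v         = suc zero ∷ zero ∷ suc zero ∷ zero ∷ z
  ; wt-u      = cong (2 +_) wt-z
  ; wt-v      = cong (2 +_) wt-z
  ; differ    = 1+n≢n
  }

-- The words a b z and (a - 1) (b + 1) z with a = b + 2 + o.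
distinguished-by-squares : ∀ {M q k} b o (z : Word (suc M) q) → 2 + b + o ≤ M →
                           2 + b + o + b + wt z ≡ k → Distinguished (suc M) (2 + q) k
distinguished-by-squares {M} {q} {k} b o z a≤M wt≡k = record
  { f         = squares
  ; invariant = squares-invariant
  ; u         = fromℕ< (s≤s a≤M) ∷ fromℕ< b<M ∷ z
  ; v         = fromℕ< a′<M ∷ fromℕ< b′<M ∷ z
  ; wt-u      = trans (cong₂ (λ a b → a + (b + wt z)) (toℕ-fromℕ< (s≤s a≤M)) (toℕ-fromℕ< b<M))
                  (trans (sym (+-assoc (2 + b + o) b (wt z))) wt≡k)
  ; wt-v      = trans (cong₂ (λ a b → a + (b + wt z)) (toℕ-fromℕ< a′<M) (toℕ-fromℕ< b′<M))
                  (trans (solve 3 (λ b o w → con 1 :+ b :+ o :+ (con 1 :+ b :+ w) := con 2 :+ b :+ o :+ b :+ w)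
                           refl b o (wt z)) wt≡k)
  ; differ    = λ eq → m≢1+n+m (squares (1 + b + o ∷ 1 + b ∷ letters z)) {1 + o + o} (begin
      squares (1 + b + o ∷ 1 + b ∷ letters z) ≡⟨ cong₂ (λ a b → squares (a ∷ b ∷ letters z)) (toℕ-fromℕ< a′<M) (toℕ-fromℕ< b′<M) ⟨
      squares (toℕ (fromℕ< a′<M) ∷ toℕ (fromℕ< b′<M) ∷ letters z) ≡⟨ eq ⟨
      squares (toℕ (fromℕ< (s≤s a≤M)) ∷ toℕ (fromℕ< b<M) ∷ letters z) ≡⟨ cong₂ (λ a b → squares (a ∷ b ∷ letters z)) (toℕ-fromℕ< (s≤s a≤M)) (toℕ-fromℕ< b<M) ⟩
      squares (2 + b + o ∷ b ∷ letters z) ≡⟨ solve 3 (λ b o w →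
          (con 2 :+ b :+ o) :* (con 2 :+ b :+ o) :+ (b :* b :+ w) :=
          con 1 :+ (con 1 :+ o :+ o :+ ((con 1 :+ b :+ o) :* (con 1 :+ b :+ o) :+ ((con 1 :+ b) :* (con 1 :+ b) :+ w))))
          refl b o (squares (letters z)) ⟩
      suc (1 + o + o + squares (1 + b + o ∷ 1 + b ∷ letters z)) ∎)
  }
  where
  open ≡-Reasoning
  open +-*-Solver
  2+b≤M : 2 + b ≤ M
  2+b≤M = ≤-trans (m≤m+n (2 + b) o) a≤M
  b<M : b < suc M
  b<M = ≤-trans (n≤1+n _) (≤-trans 2+b≤M (n≤1+n M))
  b′<M : suc b < suc M
  b′<M = ≤-trans 2+b≤M (n≤1+n M)
  a′<M : suc b + o < suc M
  a′<M = ≤-trans a≤M (n≤1+n M)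

-- It suffices to find a word of weight `k` whose first letter exceeds the second by at least 2:
-- moving one unit from the first to the second then strictly lowers the sum of squares.
distinguished-nonbinary : ∀ M q k → 2 ≤ M → 2 ≤ k → 2 + k ≤ (2 + q) * M → Distinguished (suc M) (2 + q) k
distinguished-nonbinary M q k 2≤M 2≤k 2+k≤ =
  let z , wt-z = fill M q (k ∸ c) rest≤
      o , a≡   = m≤n⇒∃[o]m+o≡n 2+b≤a
  in distinguished-by-squares b o z (≤-trans (≤-reflexive a≡) (m⊓n≤m M c)) (begin-equality
       2 + b + o + b + wt z    ≡⟨ cong₂ (λ a w → a + b + w) a≡ wt-z ⟩
       M ⊓ c + (c ∸ M) + (k ∸ c) ≡⟨ cong (_+ (k ∸ c)) (m⊓n+n∸m≡n M c) ⟩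
       c + (k ∸ c)             ≡⟨ m+[n∸m]≡n c≤k ⟩
       k                       ∎)
  where
  open ≤-Reasoning
  c b : ℕ
  -- The joint weight of the first two letters: at least 2, and at least what the other `q` letters
  -- cannot hold. The first letter takes `M ⊓ c` of it and the second takes `b`.
  c = 2 ⊔ (k ∸ q * M)
  b = c ∸ M
  c≤k : c ≤ k
  c≤k = ⊔-lub 2≤k (m∸n≤m k (q * M))
  rest≤ : k ∸ c ≤ q * M
  rest≤ = ≤-trans (∸-monoʳ-≤ k (m≤n⊔m 2 (k ∸ q * M)))
            (m≤n+o⇒m∸n≤o k (k ∸ q * M) (≤-trans (m≤n+m∸n k (q * M)) (≤-reflexive (+-comm (q * M) _))))
  -- For `c = 2` this is `4 ≤ M + M`; otherwise it is the slack of 2 between `k` and the maximal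
  -- weight.
  2+c≤2M : 2 + c ≤ M + M
  2+c≤2M = begin
    2 + (2 ⊔ (k ∸ q * M))       ≡⟨ +-distribˡ-⊔ 2 2 (k ∸ q * M) ⟩
    4 ⊔ (2 + (k ∸ q * M))       ≤⟨ ⊔-lub (+-mono-≤ 2≤M 2≤M) 2+excess≤ ⟩
    M + M                       ∎
    where
    2+excess≤ : 2 + (k ∸ q * M) ≤ M + M
    2+excess≤ with ≤-total k (q * M)
    ... | inj₁ k≤ = ≤-trans (≤-reflexive (cong (2 +_) (m≤n⇒m∸n≡0 k≤))) (≤-trans 2≤M (m≤m+n M M))
    ... | inj₂ k≥ = +-cancelʳ-≤ (q * M) _ _ (begin
      2 + (k ∸ q * M) + q * M   ≡⟨ cong (2 +_) (m∸n+n≡m k≥) ⟩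
      2 + k                     ≤⟨ 2+k≤ ⟩
      M + (M + q * M)           ≡⟨ +-assoc M M (q * M) ⟨
      M + M + q * M             ∎)
  -- If `c ≤ M`, then `b` is 0 and both `M` and `c` are at least 2. Otherwise the first letter is
  -- `M`, and `2+c≤2M` keeps the second at least 2 below it.
  2+b≤a : 2 + b ≤ M ⊓ c
  2+b≤a with ≤-total c M
  ... | inj₁ c≤M = ⊓-glb (≤-trans small 2≤M) (≤-trans small (m≤m⊔n 2 (k ∸ q * M)))
    where
    small : 2 + b ≤ 2
    small = ≤-reflexive (cong (2 +_) (m≤n⇒m∸n≡0 c≤M))
  ... | inj₂ M≤c = ⊓-glb (+-cancelʳ-≤ M _ _ 2+b+M≤) (≤-trans (+-monoˡ-≤ b 2≤M) (≤-reflexive (m+[n∸m]≡n M≤c)))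
    where
    2+b+M≤ : 2 + b + M ≤ M + M
    2+b+M≤ = ≤-trans (≤-reflexive (cong (2 +_) (m∸n+n≡m M≤c))) 2+c≤2M

distinguished : ∀ M q k → 2 ≤ q → 2 ≤ k → 2 + k ≤ q * M → Distinguished (suc M) q k
distinguished zero          q             k 2≤q 2≤k 2+k≤ =
  contradiction (≤-trans 2+k≤ (≤-reflexive (*-zeroʳ q))) λ ()
distinguished (suc zero)    q             k 2≤q 2≤k 2+k≤ =
  distinguished-binary q k 2≤k (≤-trans 2+k≤ (≤-reflexive (*-identityʳ q)))
distinguished (suc (suc M)) (suc (suc q)) k 2≤q 2≤k 2+k≤ =
  distinguished-nonbinary (2 + M) q k (s≤s (s≤s z≤n)) 2≤k 2+k≤
distinguished (suc (suc M)) (suc zero) k (s≤s ()) 2≤k 2+k≤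

-- From block structure to divisibility and the gcd.

divisor⇒¬ocycle : ∀ m d q k → 1 ≤ q * d → 1 < k → k < m * (suc q * d) ∸ 1 →
                  ¬ HasOcycle (q * d) (𝓑 k (suc m) (suc q * d))
divisor⇒¬ocycle m d zero      k () _   _
divisor⇒¬ocycle m d q@(suc _) k _  1<k k< =
  distinguished⇒¬ocycle (distinguished (d * m) (suc q) k (s≤s (s≤s z≤n)) 1<k (begin
    -- The maximal weight of a word equals that of a sequence of `suc q` block sums, each at most
    -- `d * m`, so the slack of 2 carries over.
    2 + k                    ≤⟨ s≤s k< ⟩
    1 + (m * (suc q * d) ∸ 1) ≡⟨ m+[n∸m]≡n (≤-trans (≤-trans (s≤s z≤n) k<) (m∸n≤m _ 1)) ⟩
    m * (suc q * d)          ≡⟨ solve 3 (λ m q d → m :* (q :* d) := q :* (d :* m)) refl m (suc q) d ⟩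
    suc q * (d * m)          ∎))
  where
  open ≤-Reasoning
  open +-*-Solver

∣⇒blocks : ∀ {n s} → s < n → n ∸ s ∣ n → ∃₂ λ d q → n ≡ suc q * d × s ≡ q * d
∣⇒blocks {n} {s} s<n (divides zero    n≡) = contradiction (subst (s <_) n≡ s<n) λ ()
∣⇒blocks {n} {s} s<n (divides (suc q) n≡) = n ∸ s , q , n≡ , (begin
  s                            ≡⟨ m∸[m∸n]≡n (<⇒≤ s<n) ⟨
  n ∸ (n ∸ s)                  ≡⟨ cong (_∸ (n ∸ s)) n≡ ⟩
  suc q * (n ∸ s) ∸ (n ∸ s)    ≡⟨ m+n∸m≡n (n ∸ s) (q * (n ∸ s)) ⟩
  q * (n ∸ s)                  ∎)
  where open ≡-Reasoning

ocycle⇒∤ : ∀ {m n k s} → 1 ≤ s → s < n → 1 < k → k < m * n ∸ 1 →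
           HasOcycle s (𝓑 k (suc m) n) → ¬ n ∸ s ∣ n
ocycle⇒∤ {m} {k = k} 1≤s s<n 1<k k< ocycle d∣n with d , q , refl , refl ← ∣⇒blocks s<n d∣n =
  divisor⇒¬ocycle m d q k 1≤s 1<k k< ocycle

-- Since `n` is `s + d`, `gcd n s` divides `d` and hence is at most `d`. Equality holds exactly when
-- `d` divides `n`, for then `d` divides `s` as well.
∤⇔gcd< : ∀ {n s} → s < n → (¬ n ∸ s ∣ n) ⇔ (n ∸ s > gcd n s)
∤⇔gcd< {n} {s} s<n = mk⇔ ∤⇒gcd< gcd<⇒∤
  where
  d = n ∸ s

  s+d≡n : s + d ≡ n
  s+d≡n = m+[n∸m]≡n (<⇒≤ s<n)

  ∤⇒gcd< : ¬ d ∣ n → gcd n s < d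
  ∤⇒gcd< d∤n = ≤∧≢⇒< (∣⇒≤ {{>-nonZero (m<n⇒0<n∸m s<n)}} gcd∣d) (λ gcd≡d → d∤n (subst (_∣ n) gcd≡d (gcd[m,n]∣m n s)))
    where
    gcd∣d : gcd n s ∣ d
    gcd∣d = ∣m+n∣m⇒∣n (subst (gcd n s ∣_) (sym s+d≡n) (gcd[m,n]∣m n s)) (gcd[m,n]∣n n s)

  gcd<⇒∤ : gcd n s < d → ¬ d ∣ n
  gcd<⇒∤ gcd<d d∣n = <⇒≱ gcd<d (∣⇒≤ {{gcd-nonZero}} (gcd-greatest d∣n d∣s))
    where
    d∣s : d ∣ s
    d∣s = ∣m+n∣m⇒∣n (subst (d ∣_) (trans (sym s+d≡n) (+-comm s d)) d∣n) ∣-refl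
    gcd-nonZero : NonZero (gcd n s)
    gcd-nonZero = gcd≢0 n s (inj₁ (m<n⇒n≢0 s<n))
      where gcd≢0 = λ m n p → ≢-nonZero (gcd[m,n]≢0 m n p)

theorem3p4 : (n m k s : ℕ) → 1 ≤ n → 1 ≤ m → 1 ≤ k →
    1 ≤ s → s ≤ n ∸ 1 →
    1 < k → k < (m ∸ 1) * n ∸ 1 →
    HasOcycle s (𝓑 k m n) ⇔ (n ∸ s > gcd n s)
theorem3p4 n@(suc _) m@(suc _) k s 1≤n 1≤m 1≤k 1≤s s≤n-1 1<k k< =
  mk⇔ (λ ocycle → Equivalence.to (∤⇔gcd< s<n) (ocycle⇒∤ 1≤s s<n 1<k k< ocycle))
      (λ gcd<d → Sufficiency.ocycle k s<n (Equivalence.from (∤⇔gcd< s<n) gcd<d))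
  where
  s<n : s < n
  s<n = s≤s s≤n-1
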